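{- Let $\lambda/\mu$ be a skew partition that is connected and has no empty columns, and let $\nu$ be a partition that is irreducible with respect to $\lambda/\mu$. Then for all integers $0\le m\le\lambda_1-\#\nu$ there is exactly one 12-rpp $T\in\operatorname{RPP}^{12}(\lambda/\mu;\nu)$ with $\#\nu$ mixed columns, $m$ 1-pure columns and $\lambda_1-\#\nu-m$ 2-pure columns. Moreover, these are the only elements of $\operatorname{RPP}^{12}(\lambda/\mu;\nu)$. In other words, \[ \sum_{T\in\operatorname{RPP}^{12}(\lambda/\mu;\nu)}\mathbf x^{\operatorname{ircont}(T)}=(x_1x_2)^{\#\nu}\,P_{\lambda_1-\#\nu}(x_1,x_2), \] where $P_n(x_1,x_2)=x_1^n+x_1^{n-1}x_2+\cdots+x_1x_2^{n-1}+x_2^n$.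
   Context: A partition $\lambda=(\lambda_1\ge\lambda_2\ge\cdots)$ is identified with its Young diagram $\{(i,j)\in\mathbb N_+^2\mid j\le\lambda_i\}$ ($i$ is the row, growing downwards; $j$ is the column). A skew partition $\lambda/\mu$ is a pair of partitions with $\mu\subseteq\lambda$, also identified with the set difference of the diagrams. "Connected" means connected as a subgraph of $\mathbb Z^2$, two cells being adjacent if they share an edge; "no empty columns" means each of the columns $1,\ldots,\lambda_1$ contains a cell of $\lambda/\mu$. A 12-rpp of shape $\lambda/\mu$ is a map $T:\lambda/\mu\to\{1,2\}$ weakly increasing from left to right along rows and from top to bottom down columns. A column is 1-pure if it is nonempty and all its entries are 1, 2-pure if it is nonempty and all its entries are 2, mixed if it contains both 1's and 2's. $\operatorname{ircont}(T)=(r_1,r_2,0,0,\ldots)$, where $r_i$ is the number of columns of $T$ containing an entry $i$; $\mathbf x^{\operatorname{ircont}(T)}=x_1^{r_1}x_2^{r_2}$. For a 12-rpp $T$, let $\{(i_1,j_1),\ldots,(i_s,j_s)\}$ with $j_1<\cdots<j_s$ be the set of all cells $(i,j)\in\lambda/\mu$ with $T(i,j)=1$, $(i+1,j)\in\lambda/\mu$ and $T(i+1,j)=2$. Then $i_1\ge\cdots\ge i_s$, and $\operatorname{seplist}(T):=(i_1,\ldots,i_s)$ (a partition). $\operatorname{RPP}^{12}(\lambda/\mu;\nu)$ is the set of all 12-rpps $T$ of shape $\lambda/\mu$ with $\operatorname{seplist}(T)=\nu$. For a positive integer $i$, $\operatorname{supp}(i)=\{j\mid (i,j),(i+1,j)\in\lambda/\mu\}=[\mu_i+1,\lambda_{i+1}]$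 (an integer interval). A partition $\nu=(i_1\ge\cdots\ge i_s>0)$ of length $\#\nu=s$ is admissible if $\operatorname{supp}(i_k)\ne\varnothing$ for all $k$. For integers $a<b$, $\nu|_{\subseteq[a,b)}$ is the subpartition of $\nu$ consisting of those entries $i_k$ ($1\le k\le s$, counted with multiplicity) with $\operatorname{supp}(i_k)\subseteq[a,b)$, and $\#\nu|_{\subseteq[a,b)}$ is its number of entries. An admissible $\nu$ is representable if $\#\nu|_{\subseteq[a,b)}\le b-a$ for all integers $a<b$; a representable $\nu$ is irreducible if $\#\nu|_{\subseteq[a,b)}<b-a$ for all integers $a<b$. -}

module Defs where

open import Algebra.Bundles using (CommutativeRing)
import Algebra.Properties.Semiring.Exp as Exp
import Algebra.Properties.Semiring.Sum as Sum
open import Data.Fin as Fin using (Fin; toℕ)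
open import Data.Integer as ℤ using (ℤ)
open import Data.List using (List; []; _∷_; length; map; filter; concatMap; upTo)
open import Data.List.Relation.Unary.All using (All)
open import Data.List.Relation.Unary.Linked using (Linked)
open import Data.Nat using (ℕ; zero; suc; _∸_; _≤_; _<_; _≥_; _≤?_; z≤n; s≤s; ∣_-_∣)
open import Data.Nat.Properties using (≤-trans; allUpTo?; anyUpTo?)
open import Data.Product using (Σ-syntax; ∃-syntax; _×_; _,_; proj₁; proj₂)
open import Data.Sum using (_⊎_)
open import Function using (_∘_)
open import Function.Bundles using (Inverse)
open import Level using (0ℓ; _⊔_)
open import Relation.Binary using (Setoid)
open import Relation.Binary.Construct.Closure.ReflexiveTransitive using (Star)
open import Relation.Binary.PropositionalEquality as ≡ using (_≡_; refl)
open import Relation.Nullary using (yes; no; contradiction)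
open import Relation.Nullary.Decidable using (map′; _×-dec_)
open import Relation.Unary using (Pred; Decidable; Satisfiable; _∈_; _⊆_; _∖_)
open import Relation.Unary.Properties using (_∩?_; ∁?)

record Partition : Set where
  field
    parts      : List ℕ
    decreasing : Linked _≥_ parts
    positive   : All (0 <_) parts

open Partition public using (parts)

# : Partition → ℕ
# p = length (parts p)

-- 1-based: nth xs 1 is the head.  Positions outside 1 … length xs give 0,
-- which realises λᵢ = 0 for i > #λ.
nth : List ℕ → ℕ → ℕ
nth []       _             = 0
nth (_ ∷ _)  zero          = 0
nth (x ∷ _)  (suc zero)    = x
nth (_ ∷ xs) (suc (suc i)) = nth xs (suc i)

part : Partition → ℕ → ℕ
part p = nth (parts p)

Y : Partition → Pred (ℕ × ℕ) 0ℓ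
Y p (i , j) = 1 ≤ i × 1 ≤ j × j ≤ part p i

Y? : ∀ p → Decidable (Y p)
Y? p (i , j) = (1 ≤? i) ×-dec ((1 ≤? j) ×-dec (j ≤? part p i))

record SkewPartition : Set where
  field
    outer inner : Partition
    inner⊆outer : Y inner ⊆ Y outer

open SkewPartition public

diagram : SkewPartition → Pred (ℕ × ℕ) 0ℓ
diagram S = Y (outer S) ∖ Y (inner S)

diagram? : ∀ S → Decidable (diagram S)
diagram? S = Y? (outer S) ∩? ∁? (Y? (inner S))

-- Membership is irrelevant, so a cell is determined by its coordinates and a
-- function on cells cannot depend on the membership proof.
record Cell (S : SkewPartition) : Set where
  constructor cell
  field
    row col    : ℕ
    .inDiagram : (row , col) ∈ diagram S

open Cell public using (row; col)

λ₁ : SkewPartition → ℕ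
λ₁ S = part (outer S) 1

columns : SkewPartition → List ℕ
columns S = map suc (upTo (λ₁ S))

rows : SkewPartition → List ℕ
rows S = map suc (upTo (# (outer S)))

Adjacent : ∀ {S} → Cell S → Cell S → Set
Adjacent c d = (row c ≡ row d × ∣ col c - col d ∣ ≡ 1)
             ⊎ (col c ≡ col d × ∣ row c - row d ∣ ≡ 1)

-- The empty diagram counts as connected.
Connected : SkewPartition → Set
Connected S = (c d : Cell S) → Star Adjacent c d

NonemptyColumn : SkewPartition → ℕ → Set
NonemptyColumn S j = ∃[ i ] (i , j) ∈ diagram S

NoEmptyColumns : SkewPartition → Set
NoEmptyColumns S = ∀ j → 1 ≤ j → j ≤ λ₁ S → NonemptyColumn S j

-- The ordered set {1, 2} of entries is Fin 2.
pattern 𝟏 = Fin.zero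
pattern 𝟐 = Fin.suc Fin.zero

record 12-RPP (S : SkewPartition) : Set where
  field
    entry        : Cell S → Fin 2
    rows-weak    : ∀ c d → row c ≡ row d → col c ≤ col d → entry c Fin.≤ entry d
    columns-weak : ∀ c d → col c ≡ col d → row c ≤ row d → entry c Fin.≤ entry d

open 12-RPP public using (entry)

private
  nth-bound : ∀ xs i → 1 ≤ nth xs i → i ≤ length xs
  nth-bound (_ ∷ _)  (suc zero)    _ = s≤s z≤n
  nth-bound (_ ∷ xs) (suc (suc i)) p = s≤s (nth-bound xs (suc i) p)

row-bound : ∀ S {i j} → (i , j) ∈ diagram S → i < suc (# (outer S))
row-bound S {i} ((_ , 1≤j , j≤) , _) =
  s≤s (nth-bound (parts (outer S)) i (≤-trans 1≤j j≤))

nonemptyColumn? : ∀ S → Decidable (NonemptyColumn S)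
nonemptyColumn? S j =
  map′ (λ { (i , _ , p) → i , p }) (λ { (i , p) → i , row-bound S p , p })
       (anyUpTo? (λ i → diagram? S (i , j)) (suc (# (outer S))))

module _ {S : SkewPartition} (T : 12-RPP S) where

  HasEntry : Fin 2 → Pred (ℕ × ℕ) 0ℓ
  HasEntry e (i , j) = Σ[ p ∈ (i , j) ∈ diagram S ] entry T (cell i j p) ≡ e

  hasEntry? : ∀ e → Decidable (HasEntry e)
  hasEntry? e (i , j) with diagram? S (i , j)
  ... | no ¬p = no (¬p ∘ proj₁)
  ... | yes p = map′ (p ,_) proj₂ (entry T (cell i j p) Fin.≟ e)

  Contains : Fin 2 → ℕ → Set
  Contains e j = ∃[ i ] HasEntry e (i , j)

  contains? : ∀ e → Decidable (Contains e)
  contains? e j =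
    map′ (λ { (i , _ , h) → i , h })
         (λ { (i , h) → i , row-bound S (proj₁ h) , h })
         (anyUpTo? (λ i → hasEntry? e (i , j)) (suc (# (outer S))))

  Mixed : ℕ → Set
  Mixed j = Contains 𝟏 j × Contains 𝟐 j

  mixed? : Decidable Mixed
  mixed? j = contains? 𝟏 j ×-dec contains? 𝟐 j

  Pure : Fin 2 → ℕ → Set
  Pure e j = NonemptyColumn S j
           × (∀ i (p : (i , j) ∈ diagram S) → entry T (cell i j p) ≡ e)

  pure? : ∀ e → Decidable (Pure e)
  pure? e j = nonemptyColumn? S j ×-dec
    map′ (λ h i p → h (row-bound S p) p) (λ h {i} _ p → h i p)
         (allUpTo? entry? (suc (# (outer S))))
    where
    entry? : Decidable (λ i → (p : (i , j) ∈ diagram S) → entry T (cell i j p) ≡ e)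
    entry? i with diagram? S (i , j)
    ... | no ¬p = yes (λ p → contradiction p ¬p)
    ... | yes p = map′ (λ eq _ → eq) (λ h → h p) (entry T (cell i j p) Fin.≟ e)

  #columns : {P : Pred ℕ 0ℓ} → Decidable P → ℕ
  #columns P? = length (filter P? (columns S))

  ircont : Fin 2 → ℕ
  ircont e = #columns (contains? e)

  Separates : Pred (ℕ × ℕ) 0ℓ
  Separates (i , j) = HasEntry 𝟏 (i , j) × HasEntry 𝟐 (suc i , j)

  separates? : Decidable Separates
  separates? (i , j) = hasEntry? 𝟏 (i , j) ×-dec hasEntry? 𝟐 (suc i , j)

  -- Rows of the separating cells, listed by increasing column.  A column has at
  -- most one such cell, so the order inside a column plays no role.
  seplist : List ℕ
  seplist = concatMap (λ j → filter (λ i → separates? (i , j)) (rows S)) (columns S)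

  ColumnCounts : (mixed ones twos : ℕ) → Set
  ColumnCounts mixed ones twos =
    #columns mixed? ≡ mixed × #columns (pure? 𝟏) ≡ ones × #columns (pure? 𝟐) ≡ twos

infix 4 _≈ᵀ_
_≈ᵀ_ : ∀ {S} → 12-RPP S → 12-RPP S → Set
T ≈ᵀ U = ∀ c → entry T c ≡ entry U c

-- RPP¹²(λ/μ; ν), with fillings compared entrywise.
RPP¹² : SkewPartition → Partition → Setoid 0ℓ 0ℓ
RPP¹² S ν = record
  { Carrier       = Σ[ T ∈ 12-RPP S ] seplist T ≡ parts ν
  ; _≈_           = λ T U → proj₁ T ≈ᵀ proj₁ U
  ; isEquivalence = record
    { refl  = λ _ → refl
    ; sym   = λ T≈U c → ≡.sym (T≈U c)
    ; trans = λ T≈U U≈V c → ≡.trans (T≈U c) (U≈V c)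
    }
  }

supp : SkewPartition → ℕ → Pred ℕ 0ℓ
supp S i j = (i , j) ∈ diagram S × (suc i , j) ∈ diagram S

[_,_⟩ : ℤ → ℤ → Pred ℕ 0ℓ
[ a , b ⟩ j = a ℤ.≤ ℤ.+ j × ℤ.+ j ℤ.< b

SuppWithin : SkewPartition → ℤ → ℤ → ℕ → Set
SuppWithin S a b i = supp S i ⊆ [ a , b ⟩

suppWithin? : ∀ S a b → Decidable (SuppWithin S a b)
suppWithin? S a b i =
  map′ (λ h {j} s → h (s≤s (proj₂ (proj₂ (proj₁ (proj₁ s))))) s)
       (λ h {j} _ s → h s)
       (allUpTo? within? (suc (part (outer S) i)))
  where
  supp? : Decidable (supp S i)
  supp? j = diagram? S (i , j) ×-dec diagram? S (suc i , j)

  within? : Decidable (λ j → supp S i j → [ a , b ⟩ j)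
  within? j with supp? j
  ... | no ¬s = yes (λ s → contradiction s ¬s)
  ... | yes s = map′ (λ w _ → w) (λ h → h s)
                     ((a ℤ.≤? ℤ.+ j) ×-dec (ℤ.+ j ℤ.<? b))

-- #(ν|⊆[a,b))
#within : SkewPartition → Partition → ℤ → ℤ → ℕ
#within S ν a b = length (filter (suppWithin? S a b) (parts ν))

Admissible : SkewPartition → Partition → Set
Admissible S ν = All (λ i → Satisfiable (supp S i)) (parts ν)

Representable : SkewPartition → Partition → Set
Representable S ν =
  Admissible S ν × (∀ a b → a ℤ.< b → ℤ.+ #within S ν a b ℤ.≤ b ℤ.- a)

Irreducible : SkewPartition → Partition → Set
Irreducible S ν =
  Representable S ν × (∀ a b → a ℤ.< b → ℤ.+ #within S ν a b ℤ.< b ℤ.- a)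

-- Polynomials in x₁, x₂ are read as their values at arbitrary elements of an
-- arbitrary commutative ring R; the case of a polynomial ring and its variables
-- is the formal identity.
module Polynomials {c ℓ} (R : CommutativeRing c ℓ) where

  open CommutativeRing R using (Carrier; _≈_; _*_; semiring)
  open Exp semiring public using (_^_)
  open Sum semiring using (sum)

  -- s is the sum of f over the finite set A: A is in bijection with some Fin n,
  -- and adding f up along any such bijection gives s.
  IsSumOver : ∀ {a r} (A : Setoid a r) → (Setoid.Carrier A → Carrier) → Carrier → Set (a ⊔ r ⊔ ℓ)
  IsSumOver A f s =
      (∃[ n ] Inverse (≡.setoid (Fin n)) A)
    × (∀ n (e : Inverse (≡.setoid (Fin n)) A) → sum (f ∘ Inverse.to e) ≈ s)

  x^ircont : ∀ {S} → Carrier → Carrier → 12-RPP S → Carrier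
  x^ircont x₁ x₂ T = x₁ ^ ircont T 𝟏 * x₂ ^ ircont T 𝟐

  P : ℕ → Carrier → Carrier → Carrier
  P n x₁ x₂ = sum {suc n} (λ k → x₁ ^ (n ∸ toℕ k) * x₂ ^ toℕ k)

{-# OPTIONS --safe #-}
module Submission where

-- A filling is the sequence of the heights of its columns, the height of a column being the
-- last row that is not a 2.  By connectedness a pure 2-column is never followed directly by a
-- pure 1-column, a mixed column followed by a 1-column is at the right end of the support of
-- its entry of ν, and a mixed column preceded by a 2-column is at the left end.  A 2-column with
-- a 1-column further right would thus enclose a block of mixed columns whose supports fill
-- exactly that block, which irreducibility excludes; so all 1-columns precede all 2-columns.
-- Before the last 1-column a mixed column stands as late as the entries of ν still to come
-- permit, and after it as early as its support permits.  This determines the filling from ν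
-- and the number of 1-columns, and irreducibility makes the greedy choice possible.

open import Defs
open import Algebra.Bundles using (CommutativeRing)
import Algebra.Properties.CommutativeSemigroup as CommutativeSemigroup
import Algebra.Properties.CommutativeSemiring.Exp as CommutativeExp
import Algebra.Properties.Semiring.Exp as SemiringExp
import Algebra.Properties.Semiring.Sum as SemiringSum
open import Data.Fin as Fin using (Fin; toℕ; fromℕ<)
open import Data.Fin.Properties using (toℕ-fromℕ<; toℕ-injective; toℕ≤pred[n])
open import Data.Integer as ℤ using (ℤ)
import Data.Integer.Properties as ℤ
open import Data.List using (List; []; _∷_; _++_; length; map; filter; concatMap; upTo; applyUpTo)
open import Data.List.Properties
  using (∷-injectiveˡ; ∷-injectiveʳ; filter-accept; filter-reject; filter-none; filter-all; filter-≐;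
         length-map; length-applyUpTo)
open import Data.List.Relation.Binary.Sublist.Propositional as Sublist using (_⊆_; _∷_; _∷ʳ_)
open import Data.List.Relation.Binary.Sublist.Propositional.Properties
  using (All-resp-⊆; filter⁺; length-mono-≤)
open import Data.List.Relation.Unary.All as All using (All; []; _∷_)
open import Data.List.Relation.Unary.AllPairs using (AllPairs; []; _∷_)
open import Data.List.Relation.Unary.Any using (here)
open import Data.List.Relation.Unary.Linked.Properties using (Linked⇒AllPairs)
open import Data.Nat
  using (ℕ; zero; suc; _+_; _∸_; _≤_; _<_; _≥_; _≤?_; _<?_; _≟_; z≤n; s≤s)
open import Data.Nat.Properties
open import Data.Product using (_×_; _,_; proj₁; proj₂; ∃-syntax; Σ-syntax; ∃!)
open import Data.Sum using (_⊎_; inj₁; inj₂; [_,_]′)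
open import Data.Unit using (⊤; tt)
open import Function using (_∘_; id)
open import Function.Bundles using (Inverse)
import Function.Construct.Composition as Composition
import Function.Construct.Symmetry as Symmetry
open import Level using (0ℓ)
open import Relation.Binary using (Setoid)
open import Relation.Binary.Construct.Closure.ReflexiveTransitive using (Star; ε; _◅_)
open import Relation.Binary.PropositionalEquality
open import Relation.Nullary using (¬_; Dec; yes; no; contradiction; recompute)
open import Relation.Nullary.Decidable using (_×-dec_)
open import Relation.Unary using (Pred; Decidable; _∈_)

-- Words of columns and the deadlines of separating rows.

Sorted : List ℕ → Set
Sorted = AllPairs _≥_

-- Column j occupies the rows in (A j, B j].
module Words
  (A B : ℕ → ℕ) (n : ℕ)
  (A-antitone : ∀ {j k} → j ≤ k → A k ≤ A j)
  (B-antitone : ∀ {j k} → j ≤ k → B k ≤ B j)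
  (A<B : ∀ {j} → 1 ≤ j → j ≤ n → A j < B j)
  (A<B-next : ∀ {j} → 1 ≤ j → j < n → A j < B (suc j))
  (B-support : ∀ {j} → 1 ≤ B j → j ≤ n)
  where

  -- The columns with index in (j, n]: p is the height of column j, hs the heights of the columns
  -- after it, σ the separating rows of the mixed ones and m the number of pure 1-columns.
  data Word (j p : ℕ) : List ℕ → List ℕ → ℕ → Set where
    done : j ≡ n → Word j p [] [] 0
    one  : ∀ {h hs σ m} → j < n → h ≡ B (suc j) → h ≤ p →
           Word (suc j) h hs σ m → Word j p (h ∷ hs) σ (suc m)
    two  : ∀ {h hs σ m} → j < n → h ≡ A (suc j) →
           Word (suc j) h hs σ m → Word j p (h ∷ hs) σ m
    mix  : ∀ {h hs σ m} → j < n → A (suc j) < h → h < B (suc j) → (A j < h → h ≤ p) →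
           Word (suc j) h hs σ m → Word j p (h ∷ hs) (h ∷ σ) m

  -- i < B j says that j does not exceed the right end of supp(i).
  OnTime : ℕ → List ℕ → Set
  OnTime j []      = ⊤
  OnTime j (i ∷ σ) = i < B j × OnTime (suc j) σ

  onTime? : ∀ j σ → Dec (OnTime j σ)
  onTime? j []      = yes tt
  onTime? j (i ∷ σ) = (i <? B j) ×-dec onTime? (suc j) σ

  onTime-pred : ∀ {j} σ → OnTime (suc j) σ → OnTime j σ
  onTime-pred []      _         = tt
  onTime-pred (i ∷ σ) (i< , o) = <-≤-trans i< (B-antitone (n≤1+n _)) , onTime-pred σ o

  onTime⇒< : ∀ {j} σ → OnTime j σ → All (_< B j) σ
  onTime⇒< []      _        = []
  onTime⇒< (i ∷ σ) (i< , o) = i< ∷ onTime⇒< σ (onTime-pred σ o)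

  -- An entry below `B j` makes `B j` positive, so column `j` exists; each entry thus uses up a
  -- column of its own.
  onTime-length : ∀ {j} σ → j ≤ suc n → OnTime j σ → j + length σ ≤ suc n
  onTime-length {j} []      j≤ _        = subst (_≤ suc n) (sym (+-identityʳ j)) j≤
  onTime-length {j} (i ∷ σ) _  (i< , o) =
    subst (_≤ suc n) (sym (+-suc j (length σ)))
      (onTime-length σ (s≤s (B-support (≤-<-trans z≤n i<))) o)

  -- Irreducibility for the interval [c+1, b): the two conditions on i bound supp(i) from the left
  -- and from the right, and quantifying over sublists makes the property hereditary.
  Sparse : List ℕ → Set
  Sparse σ = ∀ c b {τ} → suc c < b → τ ⊆ σ →
    All (λ i → (∀ {j} → 1 ≤ j → A j < i → c < j) × B b ≤ i) τ → suc c + length τ < b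

  sparse-tail : ∀ {i σ} → Sparse (i ∷ σ) → Sparse σ
  sparse-tail sp c b c<b τ⊆σ = sp c b c<b (_ ∷ʳ τ⊆σ)

  -- The induction drops the first k entries; they are at least as large as the remaining ones, so
  -- they enter the count through k alone.
  sparse⇒onTime′ : ∀ c k σ → Sorted σ →
    (∀ b {x τ} → suc c < b → (x ∷ τ) ⊆ σ → All (λ i → B b ≤ i) (x ∷ τ) →
       suc c + (k + length (x ∷ τ)) < b) →
    OnTime (suc (suc c) + k) σ
  sparse⇒onTime′ c k []      _             _     = tt
  sparse⇒onTime′ c k (i ∷ σ) (i≥ ∷ sorted) count =
    -- A missed deadline would put the supports of this entry and of the `k` dropped ones into the
    -- `k + 1` columns from `c + 1` to `c + 1 + k`.
    ≰⇒> (λ B≤i → <-irrefl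
          (begin-equality
            suc c + (k + 1)   ≡⟨ cong (suc c +_) (+-comm k 1) ⟩
            suc c + suc k     ≡⟨ +-suc (suc c) k ⟩
            suc (suc c) + k   ∎)
          (count (suc (suc c) + k) (m≤m+n (suc (suc c)) k)
            (refl ∷ Sublist.minimum σ) (B≤i ∷ []))) ,
    subst (λ a → OnTime a σ) (+-suc (suc (suc c)) k)
      (sparse⇒onTime′ c (suc k) σ sorted λ where
        b {x} {τ} c<b τ⊆σ bs@(B≤x ∷ _) →
          subst (_< b) (cong (suc c +_) (+-suc k _))
            (count b c<b (refl ∷ τ⊆σ)
              (≤-trans B≤x (All.lookup i≥ (Sublist.lookup τ⊆σ (here refl))) ∷ bs)))
    where
    open ≤-Reasoning

  -- The strict inequality in irreducibility leaves one spare column: supports starting at column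
  -- `c + 1` or later meet deadlines counted from `c + 2`. This slack drives both uniqueness and
  -- existence of words.
  sparse⇒onTime : ∀ {c σ} → Sorted σ → Sparse σ →
    All (λ i → ∀ {j} → 1 ≤ j → A j < i → c < j) σ → OnTime (suc (suc c)) σ
  sparse⇒onTime {c} {σ} sorted sparse starts =
    subst (λ a → OnTime (suc (suc a)) σ) (+-identityʳ c)
      (sparse⇒onTime′ c 0 σ sorted λ b c<b τ⊆σ ends →
        sparse c b c<b τ⊆σ (All.zip (All-resp-⊆ τ⊆σ starts , ends)))

  -- Uniqueness of words.

  starts-after : ∀ {c i} → i ≤ A c → ∀ {j} → 1 ≤ j → A j < i → c < j
  starts-after i≤A _ A<i = ≰⇒> λ j≤c → <⇒≱ A<i (≤-trans i≤A (A-antitone j≤c))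

  ≤-sorted : ∀ {x i σ} → i ≤ x → Sorted (i ∷ σ) → All (_≤ x) (i ∷ σ)
  ≤-sorted i≤x (i≥ ∷ _) = i≤x ∷ All.map (λ k≤i → ≤-trans k≤i i≤x) i≥

  -- Mixed columns are distinct, so the entry of index `k` (from 0) stands in column `j + 1 + k` or
  -- later; as `B` is antitone, it is below `B` at column `j + 1 + k` too.
  word⇒onTime : ∀ {j p hs σ m} → Word j p hs σ m → OnTime (suc j) σ
  word⇒onTime (done _)              = tt
  word⇒onTime (one {σ = σ} _ _ _ w) = onTime-pred σ (word⇒onTime w)
  word⇒onTime (two {σ = σ} _ _ w)   = onTime-pred σ (word⇒onTime w)
  word⇒onTime (mix _ _ h<B _ w)     = h<B , word⇒onTime w

  -- Column `j` has no 1's here. A 1-column next would violate weak increase in a row shared by both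
  -- columns. A mixed column next has its separating row at most `A j`, and its entry is the largest
  -- one left.
  after-two : ∀ {j p hs σ m} → 1 ≤ j → p ≤ A j → Sorted σ → Word j p hs σ m → All (_≤ A j) σ
  after-two _   _   _      (done _)              = []
  after-two 1≤j p≤A _      (one j<n refl B≤p _)  =
    contradiction (A<B-next 1≤j j<n) (≤⇒≯ (≤-trans B≤p p≤A))
  after-two 1≤j p≤A sorted (two _ refl w)        =
    All.map (λ i≤ → ≤-trans i≤ (A-antitone (n≤1+n _))) (after-two (s≤s z≤n) ≤-refl sorted w)
  after-two 1≤j p≤A sorted (mix _ _ _ step _)    =
    ≤-sorted (≮⇒≥ λ A<h → <⇒≱ A<h (≤-trans (step A<h) p≤A)) sorted

  -- In the applications column `j` is mixed with entry `p`, and `p ∷ σ` would still be on time one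
  -- column later. A 1-column next needs `B (suc j) ≤ p` and is excluded; a mixed column hands the
  -- slack on.
  no-ones : ∀ {j p hs σ m} → Sorted σ → Sparse σ → OnTime (suc j) (p ∷ σ) →
    Word j p hs σ m → m ≡ 0
  -- By `after-two` all supports left start after column `j`. At the first mixed column
  -- `sparse⇒onTime` then supplies the slack that `no-ones` asks for.
  no-ones-after-two : ∀ {j hs σ m} → 1 ≤ j → Sorted σ → Sparse σ →
    Word j (A j) hs σ m → m ≡ 0

  no-ones _            _      _         (done _)            = refl
  no-ones _            _      (p<B , _) (one _ refl B≤p _)  = contradiction p<B (≤⇒≯ B≤p)
  no-ones sorted       sparse _         (two _ refl w)      = no-ones-after-two (s≤s z≤n) sorted sparse w
  no-ones (_ ∷ sorted) sparse (_ , o)   (mix _ _ _ _ w)     = no-ones sorted (sparse-tail sparse) o w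

  no-ones-after-two 1≤j sorted sparse (done _) = refl
  no-ones-after-two 1≤j sorted sparse w@(one j<n refl B≤A _) =
    contradiction (A<B-next 1≤j j<n) (≤⇒≯ B≤A)
  no-ones-after-two 1≤j sorted sparse (two j<n refl w) = no-ones-after-two (s≤s z≤n) sorted sparse w
  no-ones-after-two 1≤j (i≥ ∷ sorted) sparse w@(mix j<n _ _ _ w′) =
    no-ones sorted (sparse-tail sparse)
      (sparse⇒onTime (i≥ ∷ sorted) sparse
        (All.map starts-after (after-two 1≤j ≤-refl (i≥ ∷ sorted) w)))
      w′

  -- Given `σ`, the kind of a column fixes its height, so only differing kinds must be excluded. A
  -- 2-column leaves neither a 1-column nor an entry above `A (suc j)`, while the other word would
  -- require one of them.
  word-unique : ∀ {j p hs hs′ σ m} → Sorted σ → Sparse σ →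
    Word j p hs σ m → Word j p hs′ σ m → hs ≡ hs′
  word-unique _ _ (done _)    (done _)        = refl
  word-unique _ _ (done refl) (two n<n _ _)   = contradiction n<n (n≮n _)
  word-unique _ _ (two n<n _ _) (done refl)   = contradiction n<n (n≮n _)
  word-unique so sp (one _ refl _ w) (one _ refl _ w′) = cong (_ ∷_) (word-unique so sp w w′)
  word-unique so sp (two _ refl w)   (two _ refl w′)   = cong (_ ∷_) (word-unique so sp w w′)
  word-unique (_ ∷ so) sp (mix _ _ _ _ w) (mix _ _ _ _ w′) =
    cong (_ ∷_) (word-unique so (sparse-tail sp) w w′)
  word-unique so sp (one _ _ _ _) (two _ refl w′) with no-ones-after-two (s≤s z≤n) so sp w′
  ... | ()
  word-unique so sp (two _ refl w) (one _ _ _ _) with no-ones-after-two (s≤s z≤n) so sp w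
  ... | ()
  -- Past its 1-column the first word still places every entry, so they are on time one column
  -- later. By `no-ones` the second word has no 1-column after its mixed one.
  word-unique (_ ∷ so) sp (one _ _ _ w) (mix _ _ _ _ w′)
    with no-ones so (sparse-tail sp) (word⇒onTime w) w′
  ... | ()
  word-unique (_ ∷ so) sp (mix _ _ _ _ w) (one _ _ _ w′)
    with no-ones so (sparse-tail sp) (word⇒onTime w′) w
  ... | ()
  word-unique so sp (two _ refl w) (mix _ A<h _ _ _) =
    contradiction A<h (≤⇒≯ (All.head (after-two (s≤s z≤n) ≤-refl so w)))
  word-unique so sp (mix _ A<h _ _ _) (two _ refl w′) =
    contradiction A<h (≤⇒≯ (All.head (after-two (s≤s z≤n) ≤-refl so w′)))

  -- The conditions on `h` exclude one another since `A (suc j) < B (suc j)`. This later reads the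
  -- statistics of a filling off its heights.
  word-functional : ∀ {j p hs σ σ′ m m′} →
    Word j p hs σ m → Word j p hs σ′ m′ → σ ≡ σ′ × m ≡ m′
  word-functional (done _) (done _) = refl , refl
  word-functional (one _ _ _ w) (one _ _ _ w′) with word-functional w w′
  ... | refl , refl = refl , refl
  word-functional (two _ _ w) (two _ _ w′) = word-functional w w′
  word-functional (mix _ _ _ _ w) (mix _ _ _ _ w′) with word-functional w w′
  ... | refl , refl = refl , refl
  word-functional (one j<n h≡B _ _) (two _ h≡A _) =
    contradiction (A<B (s≤s z≤n) j<n) (<-irrefl (trans (sym h≡A) h≡B))
  word-functional (two j<n h≡A _) (one _ h≡B _ _) =
    contradiction (A<B (s≤s z≤n) j<n) (<-irrefl (trans (sym h≡A) h≡B))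
  word-functional (one _ h≡B _ _) (mix _ _ h<B _ _) = contradiction h<B (<-irrefl h≡B)
  word-functional (mix _ _ h<B _ _) (one _ h≡B _ _) = contradiction h<B (<-irrefl h≡B)
  word-functional (two _ h≡A _) (mix _ A<h _ _ _) = contradiction A<h (<-irrefl (sym h≡A))
  word-functional (mix _ A<h _ _ _) (two _ h≡A _) = contradiction A<h (<-irrefl (sym h≡A))

  -- Existence of words.

  -- Greedy: while 1-columns remain, a mixed column is placed only when its deadline forces it;
  -- afterwards it is placed as soon as its support permits.
  word-exists : ∀ r {j p} → j + r ≡ n → ∀ σ m → Sorted σ → Sparse σ →
    OnTime (suc j) σ → m + length σ ≤ r → All (λ i → A j < i → i ≤ p) σ →
    (0 < m → OnTime (suc (suc j)) σ → B (suc j) ≤ p) →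
    ∃[ hs ] Word j p hs σ m
  word-exists zero {j} j+0≡n [] zero _ _ _ _ _ _ = [] , done (trans (sym (+-identityʳ j)) j+0≡n)
  word-exists (suc r) {j} {p} j+1+r≡n = place
    where
    1+j+r≡n : suc j + r ≡ n
    1+j+r≡n = trans (sym (+-suc j r)) j+1+r≡n

    j<n : j < n
    j<n = subst (suc j ≤_) 1+j+r≡n (m≤m+n (suc j) r)

    -- The deadlines provide the room: entries on time from column `j + 2` on fit into the `r`
    -- columns that remain.
    place-two : ∀ {σ} → Sorted σ → Sparse σ → OnTime (suc (suc j)) σ → All (_≤ A (suc j)) σ →
                ∃[ hs ] Word j p hs σ 0
    place-two {σ} sorted sparse onTime small =
      let hs , w = word-exists r 1+j+r≡n σ 0 sorted sparse onTime
            (+-cancelˡ-≤ (suc (suc j)) _ _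
              (≤-trans (onTime-length σ (s≤s j<n) onTime) (≤-reflexive (cong suc (sym 1+j+r≡n)))))
            (All.map (λ i≤A _ → i≤A) small) (λ ())
      in _ ∷ hs , two j<n refl w

    -- The last two premises keep rows weakly increasing from column `j` to column `j + 1`, whether
    -- the greedy rule selects a mixed column or a 1-column.
    place : ∀ σ m → Sorted σ → Sparse σ → OnTime (suc j) σ → m + length σ ≤ suc r →
      All (λ i → A j < i → i ≤ p) σ → (0 < m → OnTime (suc (suc j)) σ → B (suc j) ≤ p) →
      ∃[ hs ] Word j p hs σ m
    place [] zero sorted sparse _ _ _ _ = place-two sorted sparse tt []
    place (i ∷ σ) zero (i≥ ∷ sorted) sparse (i<B , onTime) (s≤s fits) (step ∷ _) _
      with A (suc j) <? i
    ... | yes A<i =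
      let hs , w = word-exists r 1+j+r≡n σ 0 sorted (sparse-tail sparse) onTime fits
            (All.map (λ k≤i _ → k≤i) i≥) (λ ())
      in i ∷ hs , mix j<n A<i i<B step w
    ... | no A≮i =
      -- All supports left start after column `j + 1`, so irreducibility keeps every entry on time
      -- behind a 2-column.
      place-two (i≥ ∷ sorted) sparse
        (onTime-pred (i ∷ σ)
          (sparse⇒onTime (i≥ ∷ sorted) sparse (All.map starts-after small)))
        small
      where
      small : All (_≤ A (suc j)) (i ∷ σ)
      small = ≤-sorted (≮⇒≥ A≮i) (i≥ ∷ sorted)
    place σ (suc m) sorted sparse onTime (s≤s fits) steps step-one
      with onTime? (suc (suc j)) σ
    ... | yes onTime′ =
      let hs , w = word-exists r 1+j+r≡n σ m sorted sparse onTime′ fits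
            (All.map (λ i<B _ → <⇒≤ (<-≤-trans i<B (B-antitone (n≤1+n _)))) (onTime⇒< σ onTime′))
            (λ _ _ → B-antitone (n≤1+n _))
      in _ ∷ hs , one j<n refl (step-one (s≤s z≤n) onTime′) w
    place [] (suc m) _ _ _ _ _ _ | no late = contradiction tt late
    place (i ∷ σ) (suc m) (i≥ ∷ sorted) sparse (i<B , onTime) (s≤s fits) (step ∷ _) _ | no late =
      let hs , w = word-exists r 1+j+r≡n σ (suc m) sorted (sparse-tail sparse) onTime
            (subst (_≤ r) (+-suc m (length σ)) fits)
            (All.map (λ k≤i _ → k≤i) i≥)
            -- If the rest could wait for a 1-column and `i` were below `B (suc (suc j))`, then
            -- `i ∷ σ` could have waited as well, against `late`.
            (λ _ onTime′ → ≮⇒≥ λ i<B′ → late (i<B′ , onTime′))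
      in i ∷ hs , mix j<n A<i i<B step w
      where
      A<i : A (suc j) < i
      A<i = ≰⇒> λ i≤A → late (onTime-pred (i ∷ σ)
              (sparse⇒onTime (i≥ ∷ sorted) sparse
                (All.map starts-after (≤-sorted i≤A (i≥ ∷ sorted)))))

  word-length : ∀ {j p hs σ m} → Word j p hs σ m → j + length hs ≡ n
  word-length {j} (done j≡n)      = trans (+-identityʳ j) j≡n
  word-length {j} (one _ _ _ w)   = trans (+-suc j _) (word-length w)
  word-length {j} (two _ _ w)     = trans (+-suc j _) (word-length w)
  word-length {j} (mix _ _ _ _ w) = trans (+-suc j _) (word-length w)

  -- at p hs k is the height of the k-th column to the right of one of height p.
  at : ℕ → List ℕ → ℕ → ℕ
  at p _        zero    = p
  at p []       (suc k) = 0
  at p (h ∷ hs) (suc k) = at h hs k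

  Admits : ℕ → ℕ → ℕ → Set
  Admits j p h = A (suc j) ≤ h × h ≤ B (suc j) × (A j < h → h ≤ p)

  first-admits : ∀ {j p h hs σ m} → Word j p (h ∷ hs) σ m → Admits j p h
  first-admits (one j<n refl h≤p _)    = <⇒≤ (A<B (s≤s z≤n) j<n) , ≤-refl , λ _ → h≤p
  first-admits (two j<n refl _)        =
    ≤-refl , <⇒≤ (A<B (s≤s z≤n) j<n) , λ A<h → contradiction (A-antitone (n≤1+n _)) (<⇒≱ A<h)
  first-admits (mix _ A<h h<B step _)  = <⇒≤ A<h , <⇒≤ h<B , step

  word-tail : ∀ {j p h hs σ m} → Word j p (h ∷ hs) σ m → ∃[ σ′ ] ∃[ m′ ] Word (suc j) h hs σ′ m′
  word-tail (one _ _ _ w)   = _ , _ , w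
  word-tail (two _ _ w)     = _ , _ , w
  word-tail (mix _ _ _ _ w) = _ , _ , w

  word-admits : ∀ {j p hs σ m} → Word j p hs σ m →
    ∀ k → j + k < n → Admits (j + k) (at p hs k) (at p hs (suc k))
  word-admits {j} {hs = []}     (done refl) k j+k<n = contradiction j+k<n (≤⇒≯ (m≤m+n j k))
  word-admits {j} {hs = h ∷ hs} w zero    _ rewrite +-identityʳ j = first-admits w
  word-admits {j} {hs = h ∷ hs} w (suc k) j+k<n rewrite +-suc j k =
    word-admits (proj₂ (proj₂ (word-tail w))) k j+k<n

-- Consecutive numbers and counting by filters.

range : ℕ → ℕ → List ℕ
range j zero    = []
range j (suc r) = suc j ∷ range (suc j) r

map-suc-applyUpTo : ∀ {f j} r → (∀ k → f k ≡ j + k) → map suc (applyUpTo f r) ≡ range j r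
map-suc-applyUpTo {f} {j} zero    f≗ = refl
map-suc-applyUpTo {f} {j} (suc r) f≗ =
  cong₂ _∷_ (cong suc (trans (f≗ 0) (+-identityʳ j)))
    (map-suc-applyUpTo r λ k → trans (f≗ (suc k)) (+-suc j k))

map-suc-upTo : ∀ r → map suc (upTo r) ≡ range 0 r
map-suc-upTo r = map-suc-applyUpTo r λ _ → refl

range-bounds : ∀ j r → All (λ k → j < k × k ≤ j + r) (range j r)
range-bounds j zero    = []
range-bounds j (suc r) rewrite +-suc j r =
  (≤-refl , m≤m+n (suc j) r) ∷
  All.map (λ (j<k , k≤) → <-trans (n<1+n j) j<k , k≤) (range-bounds (suc j) r)

module _ {P : Pred ℕ 0ℓ} (P? : Decidable P) {x} (Px : P x) (only-x : ∀ {i} → P i → i ≡ x) where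

  filter-range-singleton : ∀ j r → j < x → x ≤ j + r → filter P? (range j r) ≡ x ∷ []
  filter-range-singleton j zero j<x x≤ = contradiction (subst (x ≤_) (+-identityʳ j) x≤) (<⇒≱ j<x)
  filter-range-singleton j (suc r) j<x x≤ with suc j ≟ x
  ... | yes refl = trans (filter-accept P? Px)
        (cong (x ∷_) (filter-none P?
          (All.map (λ (x<k , _) Pk → <-irrefl (sym (only-x Pk)) x<k) (range-bounds x r))))
  ... | no 1+j≢x = trans (filter-reject P? (1+j≢x ∘ only-x))
        (filter-range-singleton (suc j) r (≤∧≢⇒< j<x 1+j≢x) (subst (x ≤_) (+-suc j r) x≤))

map-range-injective : ∀ {f g : ℕ → ℕ} j r → map f (range j r) ≡ map g (range j r) →
  ∀ {k} → j < k → k ≤ j + r → f k ≡ g k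
map-range-injective j zero _ {k} j<k k≤ = contradiction (subst (k ≤_) (+-identityʳ j) k≤) (<⇒≱ j<k)
map-range-injective {f} {g} j (suc r) eq {k} j<k k≤ with suc j ≟ k
... | yes refl = ∷-injectiveˡ eq
... | no 1+j≢k = map-range-injective (suc j) r (∷-injectiveʳ eq) (≤∧≢⇒< j<k 1+j≢k)
                   (subst (k ≤_) (+-suc j r) k≤)

module _ {A : Set} {P Q R : Pred A 0ℓ}
         (P? : Decidable P) (Q? : Decidable Q) (R? : Decidable R) where

  length-filter-⊎ : ∀ {xs} →
    All (λ x → (P x → Q x ⊎ R x) × (Q x → P x) × (R x → P x) × ¬ (Q x × R x)) xs →
    length (filter P? xs) ≡ length (filter Q? xs) + length (filter R? xs)
  length-filter-⊎ [] = refl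
  length-filter-⊎ {x ∷ xs} ((split , fromQ , fromR , disjoint) ∷ rest)
    with P? x | Q? x | R? x
  ... | _      | yes q | yes r = contradiction (q , r) disjoint
  ... | yes _  | yes _ | no _  = cong suc (length-filter-⊎ rest)
  ... | yes _  | no _  | yes _ = trans (cong suc (length-filter-⊎ rest)) (sym (+-suc _ _))
  ... | yes p  | no ¬q | no ¬r = contradiction (split p) [ ¬q , ¬r ]′
  ... | no ¬p  | yes q | no _  = contradiction (fromQ q) ¬p
  ... | no ¬p  | no _  | yes r = contradiction (fromR r) ¬p
  ... | no _   | no _  | no _  = length-filter-⊎ rest

-- Conjugate partitions.

-- The conjugate partition when xs is decreasing and j ≥ 1; column 0 gets all length xs rows.
conjugatePart : List ℕ → ℕ → ℕ
conjugatePart []       j = 0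
conjugatePart (x ∷ xs) j with j ≤? x
... | yes _ = suc (conjugatePart xs j)
... | no _  = 0

-- Only the initial run of rows of length at least `j` is counted; sortedness prevents a long row
-- from hiding behind a short one.
≤nth⇒≤conjugatePart : ∀ {xs i j} → Sorted xs → 1 ≤ i → 1 ≤ j → j ≤ nth xs i → i ≤ conjugatePart xs j
≤nth⇒≤conjugatePart {[]}     _ _ 1≤j j≤ = contradiction (≤-trans 1≤j j≤) λ ()
≤nth⇒≤conjugatePart {x ∷ xs} {suc i} {j} _ _ _ _ with j ≤? x
≤nth⇒≤conjugatePart {x ∷ xs} {suc zero} _ _ _ _ | yes _ = s≤s z≤n
≤nth⇒≤conjugatePart {x ∷ xs} {suc (suc i)} (_ ∷ sorted) _ 1≤j j≤ | yes _ =
  s≤s (≤nth⇒≤conjugatePart sorted (s≤s z≤n) 1≤j j≤)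
≤nth⇒≤conjugatePart {x ∷ xs} {suc zero} _ _ _ j≤ | no j≰x = contradiction j≤ j≰x
≤nth⇒≤conjugatePart {x ∷ xs} {suc (suc i)} {j} (x≥ ∷ _) _ 1≤j j≤ | no j≰x =
  contradiction (≤-trans j≤ (nth≤ x≥ (suc i))) j≰x
  where
  nth≤ : ∀ {xs} → All (x ≥_) xs → ∀ i → nth xs i ≤ x
  nth≤ []        i             = z≤n
  nth≤ (_ ∷ _)   zero          = z≤n
  nth≤ (y≤ ∷ _)  (suc zero)    = y≤
  nth≤ (_ ∷ ys≤) (suc (suc i)) = nth≤ ys≤ (suc i)

≤conjugatePart⇒≤nth : ∀ xs {i j} → 1 ≤ i → i ≤ conjugatePart xs j → j ≤ nth xs i
≤conjugatePart⇒≤nth [] (s≤s _) ()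
≤conjugatePart⇒≤nth (x ∷ xs) {suc i} {j} _ i≤ with j ≤? x
≤conjugatePart⇒≤nth (x ∷ xs) {suc zero}    _ _        | yes j≤x = j≤x
≤conjugatePart⇒≤nth (x ∷ xs) {suc (suc i)} _ (s≤s i≤) | yes _   = ≤conjugatePart⇒≤nth xs (s≤s z≤n) i≤

conjugatePart-antitone : ∀ xs {j k} → j ≤ k → conjugatePart xs k ≤ conjugatePart xs j
conjugatePart-antitone [] _ = z≤n
conjugatePart-antitone (x ∷ xs) {j} {k} j≤k with k ≤? x | j ≤? x
... | yes _   | yes _   = s≤s (conjugatePart-antitone xs j≤k)
... | yes k≤x | no j≰x  = contradiction (≤-trans j≤k k≤x) j≰x
... | no _    | _       = z≤n

conjugatePart-≤-length : ∀ xs j → conjugatePart xs j ≤ length xs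
conjugatePart-≤-length [] j = z≤n
conjugatePart-≤-length (x ∷ xs) j with j ≤? x
... | yes _ = s≤s (conjugatePart-≤-length xs j)
... | no _  = z≤n

parts-sorted : ∀ p → Sorted (parts p)
parts-sorted p = Linked⇒AllPairs (λ y≤x z≤y → ≤-trans z≤y y≤x) (Partition.decreasing p)

-- Columns of a skew diagram, and connectedness.

module Columns (S : SkewPartition) where

  n : ℕ
  n = λ₁ S

  A B : ℕ → ℕ
  A = conjugatePart (parts (inner S))
  B = conjugatePart (parts (outer S))

  A-antitone : ∀ {j k} → j ≤ k → A k ≤ A j
  A-antitone = conjugatePart-antitone (parts (inner S))

  B-antitone : ∀ {j k} → j ≤ k → B k ≤ B j
  B-antitone = conjugatePart-antitone (parts (outer S))

  ∈⇒1≤col : ∀ {i j} → (i , j) ∈ diagram S → 1 ≤ j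
  ∈⇒1≤col ((_ , 1≤j , _) , _) = 1≤j

  ∈⇒A< : ∀ {i j} → (i , j) ∈ diagram S → A j < i
  ∈⇒A< ((1≤i , 1≤j , _) , ∉inner) =
    ≰⇒> λ i≤A → ∉inner (1≤i , 1≤j , ≤conjugatePart⇒≤nth (parts (inner S)) 1≤i i≤A)

  ∈⇒≤B : ∀ {i j} → (i , j) ∈ diagram S → i ≤ B j
  ∈⇒≤B ((1≤i , 1≤j , j≤) , _) = ≤nth⇒≤conjugatePart (parts-sorted (outer S)) 1≤i 1≤j j≤

  ∈-intro : ∀ {i j} → 1 ≤ j → A j < i → i ≤ B j → (i , j) ∈ diagram S
  ∈-intro {i} {j} 1≤j A<i i≤B =
    (1≤i , 1≤j , ≤conjugatePart⇒≤nth (parts (outer S)) 1≤i i≤B) ,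
    λ (_ , _ , j≤) → <⇒≱ A<i (≤nth⇒≤conjugatePart (parts-sorted (inner S)) 1≤i 1≤j j≤)
    where
    1≤i : 1 ≤ i
    1≤i = ≤-<-trans z≤n A<i

  cell∈ : (c : Cell S) → (row c , col c) ∈ diagram S
  cell∈ (cell i j c∈) = recompute (diagram? S (i , j)) c∈

  -- The lowest cell of `inner S` in column `j` also lies in `outer S`.
  A≤B : ∀ {j} → 1 ≤ j → A j ≤ B j
  A≤B {j} 1≤j with A j in eq
  ... | zero  = z≤n
  ... | suc i = ≤nth⇒≤conjugatePart (parts-sorted (outer S)) (s≤s z≤n) 1≤j
    (proj₂ (proj₂ (inner⊆outer S (s≤s z≤n , 1≤j ,
      ≤conjugatePart⇒≤nth (parts (inner S)) (s≤s z≤n) (≤-reflexive (sym eq))))))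

  B-support : ∀ {j} → 1 ≤ B j → j ≤ n
  B-support = ≤conjugatePart⇒≤nth (parts (outer S)) ≤-refl

  ∈⇒col≤n : ∀ {i j} → (i , j) ∈ diagram S → j ≤ n
  ∈⇒col≤n c∈ = B-support (≤-trans (≤-<-trans z≤n (∈⇒A< c∈)) (∈⇒≤B c∈))

  nonempty⇒A<B : ∀ {j} → NonemptyColumn S j → A j < B j
  nonempty⇒A<B (_ , c∈) = <-≤-trans (∈⇒A< c∈) (∈⇒≤B c∈)

  -- Some step leaves the columns up to `j`. It is horizontal of length 1, so it joins columns `j`
  -- and `j + 1` within one row.
  path-crosses : ∀ {j} {c d : Cell S} → Star Adjacent c d → col c ≤ j → j < col d →
    ∃[ i ] ((i , j) ∈ diagram S × (i , suc j) ∈ diagram S)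
  path-crosses ε c≤j j<c = contradiction j<c (≤⇒≯ c≤j)
  path-crosses {j} {c} (_◅_ {j = c′} adj path) c≤j j<d with col c′ ≤? j
  ... | yes c′≤j = path-crosses path c′≤j j<d
  ... | no c′≰j with adj
  ...   | inj₂ (col≡ , _) = contradiction (subst (_≤ j) col≡ c≤j) c′≰j
  ...   | inj₁ (row≡ , dist) = row c , subst (λ k → (row c , k) ∈ diagram S) c≡j (cell∈ c) ,
            subst₂ (λ i k → (i , k) ∈ diagram S) (sym row≡) (trans c′≡1+c (cong suc c≡j)) (cell∈ c′)
    where
    j<c′ : j < col c′
    j<c′ = ≰⇒> c′≰j

    c≤c′ : col c ≤ col c′
    c≤c′ = ≤-trans c≤j (<⇒≤ j<c′)

    c′≡1+c : col c′ ≡ suc (col c)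
    c′≡1+c = trans (sym (m∸n+n≡m c≤c′))
               (cong (_+ col c) (trans (sym (m≤n⇒∣m-n∣≡n∸m c≤c′)) dist))

    c≡j : col c ≡ j
    c≡j = ≤-antisym c≤j (≤-pred (subst (j <_) c′≡1+c j<c′))

  -- A path between the two columns crosses in a row `i` with `A j < i` and `i ≤ B (suc j)`.
  A<B-next : Connected S → NoEmptyColumns S → ∀ {j} → 1 ≤ j → j < n → A j < B (suc j)
  A<B-next connected full {j} 1≤j j<n =
    let _ , c∈ = full j 1≤j (<⇒≤ j<n)
        _ , d∈ = full (suc j) (s≤s z≤n) j<n
        _ , l∈ , r∈ = path-crosses (connected (cell _ j c∈) (cell _ (suc j) d∈)) ≤-refl ≤-refl
    in <-≤-trans (∈⇒A< l∈) (∈⇒≤B r∈)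

-- Entries 1 and 2.

≢𝟏⇒≡𝟐 : ∀ {e : Fin 2} → ¬ e ≡ 𝟏 → e ≡ 𝟐
≢𝟏⇒≡𝟐 {𝟏} e≢𝟏 = contradiction refl e≢𝟏
≢𝟏⇒≡𝟐 {𝟐} _   = refl

≢𝟐⇒≡𝟏 : ∀ {e : Fin 2} → ¬ e ≡ 𝟐 → e ≡ 𝟏
≢𝟐⇒≡𝟏 {𝟏} _   = refl
≢𝟐⇒≡𝟏 {𝟐} e≢𝟐 = contradiction refl e≢𝟐

≡𝟏⇒≢𝟐 : ∀ {e : Fin 2} → e ≡ 𝟏 → ¬ e ≡ 𝟐
≡𝟏⇒≢𝟐 refl ()

≤𝟏⇒≡𝟏 : ∀ {e f : Fin 2} → e Fin.≤ f → f ≡ 𝟏 → e ≡ 𝟏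
≤𝟏⇒≡𝟏 {𝟏} _ refl = refl

threshold : ∀ {P : Set} → Dec P → Fin 2
threshold (yes _) = 𝟏
threshold (no _)  = 𝟐

threshold-mono : ∀ {P Q : Set} (p? : Dec P) (q? : Dec Q) → (Q → P) → threshold p? Fin.≤ threshold q?
threshold-mono (yes _) _       _   = z≤n
threshold-mono (no ¬p) (yes q) Q→P = contradiction (Q→P q) ¬p
threshold-mono (no _)  (no _)  _   = ≤-refl

threshold≡𝟏⇒ : ∀ {P : Set} (p? : Dec P) → threshold p? ≡ 𝟏 → P
threshold≡𝟏⇒ (yes p) _ = p

⇒threshold≡𝟏 : ∀ {P : Set} (p? : Dec P) → P → threshold p? ≡ 𝟏
⇒threshold≡𝟏 (yes _) _ = refl
⇒threshold≡𝟏 (no ¬p) p = contradiction p ¬p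

-- Fillings, height functions and words.

module Fillings (S : SkewPartition) (connected : Connected S) (full : NoEmptyColumns S) where

  open Columns S
  open Words A B n A-antitone B-antitone
    (λ 1≤j j≤n → nonempty⇒A<B (full _ 1≤j j≤n))
    (A<B-next connected full) B-support public

  -- Column 0 is a virtual column of 1's of height B 0; it imposes no condition on column 1.
  record HeightFunction (T : 12-RPP S) (h : ℕ → ℕ) : Set where
    field
      height-zero : h 0 ≡ B 0
      A≤height    : ∀ {j} → 1 ≤ j → j ≤ n → A j ≤ h j
      height≤B    : ∀ {j} → 1 ≤ j → j ≤ n → h j ≤ B j
      𝟏⇒≤height   : ∀ (c : Cell S) → entry T c ≡ 𝟏 → row c ≤ h (col c)
      ≤height⇒𝟏   : ∀ (c : Cell S) → row c ≤ h (col c) → entry T c ≡ 𝟏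

  -- Induction on the number `d` of top cells considered. If the lowest of them is a 1, so are all
  -- above it; otherwise the cells above it decide.
  column-height : ∀ (T : 12-RPP S) {j} → 1 ≤ j → ∀ d → A j + d ≤ B j →
    ∃[ h ] (A j ≤ h × h ≤ A j + d ×
      (∀ i (p : (i , j) ∈ diagram S) → i ≤ A j + d →
        (entry T (cell i j p) ≡ 𝟏 → i ≤ h) × (i ≤ h → entry T (cell i j p) ≡ 𝟏)))
  column-height T {j} 1≤j zero _ = A j , ≤-refl , m≤m+n (A j) 0 , λ i p i≤ →
    let i≤A = subst (i ≤_) (+-identityʳ (A j)) i≤
    in contradiction i≤A (<⇒≱ (∈⇒A< p))
  column-height T {j} 1≤j (suc d) A+1+d≤B
    with hasEntry? T 𝟏 (A j + suc d , j)
  ... | yes (p , ≡𝟏) = A j + suc d , m≤m+n (A j) (suc d) , ≤-refl , λ i q i≤ →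
          (λ _ → i≤) ,
          (λ _ → ≤𝟏⇒≡𝟏 (12-RPP.columns-weak T (cell i j q) (cell _ j p) refl i≤) ≡𝟏)
  ... | no ∄𝟏 =
    let h , A≤h , h≤ , spec = column-height T 1≤j d
          (≤-trans (+-monoʳ-≤ (A j) (n≤1+n d)) A+1+d≤B)
    in h , A≤h , ≤-trans h≤ (+-monoʳ-≤ (A j) (n≤1+n d)) , λ i q i≤ → extend h h≤ spec i q (m≤n⇒m<n∨m≡n i≤)
    where
    extend : ∀ h → h ≤ A j + d → (∀ i (p : (i , j) ∈ diagram S) → i ≤ A j + d →
        (entry T (cell i j p) ≡ 𝟏 → i ≤ h) × (i ≤ h → entry T (cell i j p) ≡ 𝟏)) →
      ∀ i (p : (i , j) ∈ diagram S) → i < A j + suc d ⊎ i ≡ A j + suc d →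
        (entry T (cell i j p) ≡ 𝟏 → i ≤ h) × (i ≤ h → entry T (cell i j p) ≡ 𝟏)
    extend h h≤ spec i q (inj₁ i<) = spec i q (≤-pred (subst (i <_) (+-suc (A j) d) i<))
    extend h h≤ spec i q (inj₂ refl) =
      (λ ≡𝟏 → contradiction (q , ≡𝟏) ∄𝟏) ,
      (λ i≤h → contradiction (subst (_≤ A j + d) (+-suc (A j) d) (≤-trans i≤h h≤)) (n≮n _))

  heights : ∀ T → ∃[ h ] HeightFunction T h
  heights T = h , record
    { height-zero = refl
    ; A≤height    = λ { (s≤s z≤n) _ → proj₁ (proj₂ (spec _)) }
    ; height≤B    = λ { (s≤s z≤n) _ → ≤-trans (proj₁ (proj₂ (proj₂ (spec _)))) (≤-reflexive (A+[B∸A]≡B _)) }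
    ; 𝟏⇒≤height   = λ c → proj₁ (at-cell c (cell∈ c))
    ; ≤height⇒𝟏   = λ c → proj₂ (at-cell c (cell∈ c))
    }
    where
    A+[B∸A]≡B : ∀ j → A (suc j) + (B (suc j) ∸ A (suc j)) ≡ B (suc j)
    A+[B∸A]≡B j = m+[n∸m]≡n (A≤B (s≤s z≤n))

    spec : ∀ j → _
    spec j = column-height T {suc j} (s≤s z≤n) (B (suc j) ∸ A (suc j)) (≤-reflexive (A+[B∸A]≡B j))

    h : ℕ → ℕ
    h zero    = B 0
    h (suc j) = proj₁ (spec j)

    at-cell : ∀ c → (row c , col c) ∈ diagram S →
      (entry T c ≡ 𝟏 → row c ≤ h (col c)) × (row c ≤ h (col c) → entry T c ≡ 𝟏)
    at-cell (cell i zero _)    p = contradiction (∈⇒1≤col p) λ ()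
    at-cell (cell i (suc j) _) p =
      proj₂ (proj₂ (proj₂ (spec j))) i p (≤-trans (∈⇒≤B p) (≤-reflexive (sym (A+[B∸A]≡B j))))

  module _ {T : 12-RPP S} {h : ℕ → ℕ} (H : HeightFunction T h) where
    open HeightFunction H

    height-one≤height-zero : 0 < n → h 1 ≤ h 0
    height-one≤height-zero 0<n =
      ≤-trans (height≤B (s≤s z≤n) 0<n) (≤-trans (B-antitone z≤n) (≤-reflexive (sym height-zero)))

    -- The premise says that the row of the lowest 1 of column `j + 1` also meets column `j`; the
    -- cell there is left of a 1, hence a 1.
    height-step : ∀ {j} → j < n → A j < h (suc j) → h (suc j) ≤ h j
    height-step {zero}  0<n _   = height-one≤height-zero 0<n
    height-step {suc j} j<n A<h = 𝟏⇒≤height c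
        (≤𝟏⇒≡𝟏 (12-RPP.rows-weak T c d refl (n≤1+n _)) (≤height⇒𝟏 d ≤-refl))
      where
      c d : Cell S
      c = cell (h (suc (suc j))) (suc j)
            (∈-intro (s≤s z≤n) A<h (≤-trans (height≤B (s≤s z≤n) j<n) (B-antitone (n≤1+n _))))
      d = cell (h (suc (suc j))) (suc (suc j))
            (∈-intro (s≤s z≤n) (≤-<-trans (A-antitone (n≤1+n _)) A<h) (height≤B (s≤s z≤n) j<n))

    𝟐⇒height< : ∀ (c : Cell S) → entry T c ≡ 𝟐 → h (col c) < row c
    𝟐⇒height< c ≡𝟐 = ≰⇒> λ ≤h → ≡𝟏⇒≢𝟐 (≤height⇒𝟏 c ≤h) ≡𝟐

    height<⇒𝟐 : ∀ (c : Cell S) → h (col c) < row c → entry T c ≡ 𝟐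
    height<⇒𝟐 c h< = ≢𝟏⇒≡𝟐 (λ ≡𝟏 → <⇒≱ h< (𝟏⇒≤height c ≡𝟏))

    separates⇒height : ∀ {i j} → Separates T (i , j) → A j < h j × h j < B j × i ≡ h j
    separates⇒height {i} {j} ((p , ≡𝟏) , (q , ≡𝟐)) =
      <-≤-trans (∈⇒A< p) i≤h , ≤-trans h<1+i (∈⇒≤B q) , ≤-antisym i≤h (≤-pred h<1+i)
      where
      i≤h : i ≤ h j
      i≤h = 𝟏⇒≤height (cell i j p) ≡𝟏

      h<1+i : h j < suc i
      h<1+i = 𝟐⇒height< (cell (suc i) j q) ≡𝟐

    height-separates : ∀ {j} → 1 ≤ j → A j < h j → h j < B j → Separates T (h j , j)
    height-separates 1≤j A<h h<B =
      (∈-intro 1≤j A<h (<⇒≤ h<B) , ≤height⇒𝟏 (cell _ _ _) ≤-refl) ,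
      (∈-intro 1≤j (<-trans A<h (n<1+n _)) h<B , height<⇒𝟐 (cell _ _ _) ≤-refl)

    separatorRows : ℕ → List ℕ
    separatorRows j = filter (λ i → separates? T (i , j)) (rows S)

    separatorRows-none : ∀ {j} → ¬ (A j < h j × h j < B j) → separatorRows j ≡ []
    separatorRows-none {j} ¬mixed = filter-none (λ i → separates? T (i , j)) {xs = rows S}
      (All.universal (λ i s → let A<h , h<B , _ = separates⇒height s in ¬mixed (A<h , h<B)) _)

    separatorRows-one : ∀ {j} → 1 ≤ j → A j < h j → h j < B j → separatorRows j ≡ h j ∷ []
    separatorRows-one {j} 1≤j A<h h<B = trans (cong (filter λ i → separates? T (i , j)) (map-suc-upTo (# (outer S))))
      (filter-range-singleton (λ i → separates? T (i , j)) (height-separates 1≤j A<h h<B)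
        (λ s → proj₂ (proj₂ (separates⇒height s))) 0 (# (outer S))
        (≤-<-trans z≤n A<h) (≤-trans (<⇒≤ h<B) (conjugatePart-≤-length (parts (outer S)) j)))

    -- One case distinction that serves both the word of a filling and the count of its mixed
    -- columns.
    data ColumnKind (j : ℕ) : Set where
      all-𝟏 : h j ≡ B j → Pure T 𝟏 j → ¬ Mixed T j → separatorRows j ≡ [] → ColumnKind j
      all-𝟐 : h j ≡ A j → ¬ Pure T 𝟏 j → ¬ Mixed T j → separatorRows j ≡ [] → ColumnKind j
      both  : A j < h j → h j < B j → ¬ Pure T 𝟏 j → Mixed T j → separatorRows j ≡ h j ∷ [] →
              ColumnKind j

    columnKind : ∀ {j} → 1 ≤ j → j ≤ n → ColumnKind j
    columnKind {j} 1≤j j≤n with h j ≟ B j | h j ≟ A j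
    ... | yes h≡B | _ = all-𝟏 h≡B (full j 1≤j j≤n , λ i p → ≤height⇒𝟏 _ (≤B⇒≤h p))
          (λ (_ , i , p , ≡𝟐) → <⇒≱ (𝟐⇒height< (cell i j p) ≡𝟐) (≤B⇒≤h p))
          (separatorRows-none λ (_ , h<B) → <-irrefl h≡B h<B)
      where
      ≤B⇒≤h : ∀ {i} → (i , j) ∈ diagram S → i ≤ h j
      ≤B⇒≤h p = ≤-trans (∈⇒≤B p) (≤-reflexive (sym h≡B))
    ... | no h≢B | yes h≡A = all-𝟐 h≡A
          -- The bottom cell of the column, in row `B j`, is a 2.
          (λ (_ , pure) → <⇒≱ h<B (𝟏⇒≤height (cell (B j) j B∈) (pure (B j) B∈)))
          (λ ((i , p , ≡𝟏) , _) → <⇒≱ (∈⇒A< p) (≤-trans (𝟏⇒≤height (cell i j p) ≡𝟏) (≤-reflexive h≡A)))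
          (separatorRows-none λ (A<h , _) → <-irrefl (sym h≡A) A<h)
      where
      h<B : h j < B j
      h<B = ≤∧≢⇒< (height≤B 1≤j j≤n) h≢B
      B∈ : (B j , j) ∈ diagram S
      B∈ = ∈-intro 1≤j (nonempty⇒A<B (full j 1≤j j≤n)) ≤-refl
    ... | no h≢B | no h≢A = both A<h h<B
          (λ (_ , pure) → ≡𝟏⇒≢𝟐 (pure _ (proj₁ (proj₂ separates))) (proj₂ (proj₂ separates)))
          ((_ , proj₁ separates) , (_ , proj₂ separates))
          (separatorRows-one 1≤j A<h h<B)
      where
      h<B : h j < B j
      h<B = ≤∧≢⇒< (height≤B 1≤j j≤n) h≢B
      A<h : A j < h j
      A<h = ≤∧≢⇒< (A≤height 1≤j j≤n) (h≢A ∘ sym)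
      separates : Separates T (h j , j)
      separates = height-separates 1≤j A<h h<B

    heights-word′ : ∀ j r → j + r ≡ n →
      Word j (h j) (map h (range j r)) (concatMap separatorRows (range j r))
        (length (filter (pure? T 𝟏) (range j r)))
    heights-word′ j zero    j+0≡n = done (trans (sym (+-identityʳ j)) j+0≡n)
    heights-word′ j (suc r) j+1+r≡n = extend (columnKind (s≤s z≤n) j<n)
      where
      1+j+r≡n : suc j + r ≡ n
      1+j+r≡n = trans (sym (+-suc j r)) j+1+r≡n

      j<n : j < n
      j<n = subst (suc j ≤_) 1+j+r≡n (m≤m+n (suc j) r)

      rest = range (suc j) r

      w = heights-word′ (suc j) r 1+j+r≡n

      -- For `j ≥ 1` connectedness gives `A j < B (suc j)`, so `height-step` applies to a 1-column.
      one-step : ∀ {j} → j < n → h (suc j) ≡ B (suc j) → h (suc j) ≤ h j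
      one-step {zero}  0<n _   = height-one≤height-zero 0<n
      one-step {suc j} j<n h≡B = height-step j<n (subst (A (suc j) <_) (sym h≡B) (A<B-next connected full (s≤s z≤n) j<n))

      extend : ColumnKind (suc j) → Word j (h j) (h (suc j) ∷ map h rest)
        (separatorRows (suc j) ++ concatMap separatorRows rest)
        (length (filter (pure? T 𝟏) (suc j ∷ rest)))
      extend (all-𝟏 h≡B pure _ rows≡) =
        subst₂ (Word j _ _) (cong (_++ concatMap separatorRows rest) (sym rows≡))
          (cong length (sym (filter-accept (pure? T 𝟏) pure)))
          (one j<n h≡B (one-step j<n h≡B) w)
      extend (all-𝟐 h≡A ¬pure _ rows≡) =
        subst₂ (Word j _ _) (cong (_++ concatMap separatorRows rest) (sym rows≡))
          (cong length (sym (filter-reject (pure? T 𝟏) ¬pure)))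
          (two j<n h≡A w)
      extend (both A<h h<B ¬pure _ rows≡) =
        subst₂ (Word j _ _) (cong (_++ concatMap separatorRows rest) (sym rows≡))
          (cong length (sym (filter-reject (pure? T 𝟏) ¬pure)))
          (mix j<n A<h h<B (height-step j<n) w)

    heights-word : Word 0 (B 0) (map h (range 0 n)) (seplist T) (#columns T (pure? T 𝟏))
    heights-word = subst₂ (λ p js → Word 0 p (map h (range 0 n)) (concatMap separatorRows js)
                                      (length (filter (pure? T 𝟏) js)))
      height-zero (sym (map-suc-upTo n)) (heights-word′ 0 n refl)

    #mixed≡length-separators : ∀ {js} → All (λ j → 1 ≤ j × j ≤ n) js →
      length (filter (mixed? T) js) ≡ length (concatMap separatorRows js)
    #mixed≡length-separators [] = refl
    #mixed≡length-separators {j ∷ js} ((1≤j , j≤n) ∷ bounds) with columnKind 1≤j j≤n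
    ... | all-𝟏 _ _ ¬mixed rows≡ rewrite filter-reject (mixed? T) {xs = js} ¬mixed | rows≡ =
      #mixed≡length-separators bounds
    ... | all-𝟐 _ _ ¬mixed rows≡ rewrite filter-reject (mixed? T) {xs = js} ¬mixed | rows≡ =
      #mixed≡length-separators bounds
    ... | both _ _ _ mixed rows≡ rewrite filter-accept (mixed? T) {xs = js} mixed | rows≡ =
      cong suc (#mixed≡length-separators bounds)

  -- From words back to fillings.

  map-at-range : ∀ {f j p} hs → (∀ k → f (j + k) ≡ at p hs k) → map f (range j (length hs)) ≡ hs
  map-at-range []       _  = refl
  map-at-range {f} {j} (h ∷ hs) f≗ =
    cong₂ _∷_ (trans (cong f (+-comm 1 j)) (f≗ 1))
      (map-at-range hs λ k → trans (cong f (sym (+-suc j k))) (f≗ (suc k)))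

  module _ {hs σ m} (w : Word 0 (B 0) hs σ m) where

    h : ℕ → ℕ
    h = at (B 0) hs

    private
      h-admits : ∀ {j} → j < n → Admits j (h j) (h (suc j))
      h-admits = word-admits w _

      -- A 1 in row `i` moves left one column at a time. As `A` is antitone, `i` exceeds `A` at each
      -- column on the way, so the third condition of `Admits` applies.
      h-weak : ∀ {i j} k → A j < i → i ≤ B (k + j) → i ≤ h (k + j) → i ≤ h j
      h-weak zero    _   _   i≤h = i≤h
      h-weak {i} {j} (suc k) A<i i≤B i≤h =
        h-weak k A<i (≤-trans i≤B (B-antitone (n≤1+n (k + j))))
          (≤-trans i≤h (proj₂ (proj₂ (h-admits k+j<n))
            (<-≤-trans (≤-<-trans (A-antitone (m≤n+m j k)) A<i) i≤h)))
        where
        k+j<n : k + j < n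
        k+j<n = B-support (≤-trans (≤-<-trans z≤n A<i) i≤B)

    fromWord : 12-RPP S
    fromWord = record
      { entry = λ c → threshold (row c ≤? h (col c))
      ; rows-weak = λ c d row≡ c≤d → threshold-mono (row c ≤? h (col c)) (row d ≤? h (col d)) λ d≤h →
          subst (_≤ h (col c)) (sym row≡)
            (h-weak (col d ∸ col c) (subst (A (col c) <_) row≡ (∈⇒A< (cell∈ c)))
              (subst (λ k → row d ≤ B k) (sym (m∸n+n≡m c≤d)) (∈⇒≤B (cell∈ d)))
              (subst (λ k → row d ≤ h k) (sym (m∸n+n≡m c≤d)) d≤h))
      ; columns-weak = λ c d col≡ c≤d → threshold-mono (row c ≤? h (col c)) (row d ≤? h (col d)) λ d≤h →
          ≤-trans c≤d (subst (λ k → row d ≤ h k) (sym col≡) d≤h)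
      }

    fromWord-heights : HeightFunction fromWord h
    fromWord-heights = record
      { height-zero = refl
      ; A≤height    = λ { (s≤s z≤n) j<n → proj₁ (h-admits j<n) }
      ; height≤B    = λ { (s≤s z≤n) j<n → proj₁ (proj₂ (h-admits j<n)) }
      ; 𝟏⇒≤height   = λ c → threshold≡𝟏⇒ (row c ≤? h (col c))
      ; ≤height⇒𝟏   = λ c → ⇒threshold≡𝟏 (row c ≤? h (col c))
      }

    -- `heights-word` gives a word carrying the statistics of the new filling; it has the heights of
    -- `w`, and heights determine the statistics.
    fromWord-statistics : seplist fromWord ≡ σ × #columns fromWord (pure? fromWord 𝟏) ≡ m
    fromWord-statistics = word-functional (heights-word fromWord-heights)
      (subst (λ hs′ → Word 0 (B 0) hs′ σ m)
        (sym (trans (cong (λ r → map h (range 0 r)) (sym (word-length w))) (map-at-range hs λ _ → refl))) w)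

  ≈ᵀ-from-heights : ∀ {T U h h′} → HeightFunction T h → HeightFunction U h′ →
    map h (range 0 n) ≡ map h′ (range 0 n) → T ≈ᵀ U
  ≈ᵀ-from-heights {T} {U} {h} {h′} H H′ eq c = same-entry (entry T c) (entry U c) refl refl
    where
    open HeightFunction

    h≡h′ : h (col c) ≡ h′ (col c)
    h≡h′ = map-range-injective 0 n eq (∈⇒1≤col (cell∈ c)) (∈⇒col≤n (cell∈ c))

    same-entry : ∀ e f → entry T c ≡ e → entry U c ≡ f → e ≡ f
    same-entry 𝟏 𝟏 _  _  = refl
    same-entry 𝟐 𝟐 _  _  = refl
    same-entry 𝟏 𝟐 t≡ u≡ = contradiction u≡
      (≡𝟏⇒≢𝟐 (≤height⇒𝟏 H′ c (subst (row c ≤_) h≡h′ (𝟏⇒≤height H c t≡))))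
    same-entry 𝟐 𝟏 t≡ u≡ = contradiction t≡
      (≡𝟏⇒≢𝟐 (≤height⇒𝟏 H c (subst (row c ≤_) (sym h≡h′) (𝟏⇒≤height H′ c u≡))))

  columns-bounds : All (λ j → 1 ≤ j × j ≤ n) (columns S)
  columns-bounds = subst (All _) (sym (map-suc-upTo n)) (range-bounds 0 n)

  #mixed≡length-seplist : ∀ T → #columns T (mixed? T) ≡ length (seplist T)
  #mixed≡length-seplist T = #mixed≡length-separators (proj₂ (heights T)) columns-bounds

  seplist-unique : ∀ {T U} → Sorted (seplist T) → Sparse (seplist T) → seplist T ≡ seplist U →
    #columns T (pure? T 𝟏) ≡ #columns U (pure? U 𝟏) → T ≈ᵀ U
  seplist-unique {T} {U} sorted sparse sep≡ ones≡ =
    let h , H = heights T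
        h′ , H′ = heights U
    in ≈ᵀ-from-heights H H′ (word-unique sorted sparse (heights-word H)
         (subst₂ (Word 0 (B 0) (map h′ (range 0 n))) (sym sep≡) (sym ones≡) (heights-word H′)))

  -- Counting mixed and pure columns.

  module _ (T : 12-RPP S) where

    pure-unless : ∀ {e e′ : Fin 2} {j} → (∀ {f : Fin 2} → ¬ f ≡ e′ → f ≡ e) →
      NonemptyColumn S j → ¬ Contains T e′ j → Pure T e j
    pure-unless ≢e′⇒≡e nonempty ∌e′ = nonempty , λ i p → ≢e′⇒≡e λ ≡e′ → ∌e′ (i , p , ≡e′)

    pure⇒contains : ∀ {e j} → Pure T e j → Contains T e j
    pure⇒contains ((i , p) , pure) = i , p , pure i p

    contains⇒nonempty : ∀ {e j} → Contains T e j → NonemptyColumn S j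
    contains⇒nonempty (i , p , _) = i , p

    pure𝟏⇒∌𝟐 : ∀ {j} → Pure T 𝟏 j → ¬ Contains T 𝟐 j
    pure𝟏⇒∌𝟐 (_ , pure) (i , p , ≡𝟐) = ≡𝟏⇒≢𝟐 (pure i p) ≡𝟐

    pure𝟐⇒∌𝟏 : ∀ {j} → Pure T 𝟐 j → ¬ Contains T 𝟏 j
    pure𝟐⇒∌𝟏 (_ , pure) (i , p , ≡𝟏) = ≡𝟏⇒≢𝟐 ≡𝟏 (pure i p)

    ircont𝟏 : ircont T 𝟏 ≡ #columns T (mixed? T) + #columns T (pure? T 𝟏)
    ircont𝟏 = length-filter-⊎ (contains? T 𝟏) (mixed? T) (pure? T 𝟏) (All.universal split (columns S))
      where
      split : ∀ j → _
      split j = classify , proj₁ , pure⇒contains , λ ((_ , ∋𝟐) , pure) → pure𝟏⇒∌𝟐 pure ∋𝟐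
        where
        classify : Contains T 𝟏 j → Mixed T j ⊎ Pure T 𝟏 j
        classify ∋𝟏 with contains? T 𝟐 j
        ... | yes ∋𝟐 = inj₁ (∋𝟏 , ∋𝟐)
        ... | no ∌𝟐  = inj₂ (pure-unless ≢𝟐⇒≡𝟏 (contains⇒nonempty ∋𝟏) ∌𝟐)

    ircont𝟐 : ircont T 𝟐 ≡ #columns T (mixed? T) + #columns T (pure? T 𝟐)
    ircont𝟐 = length-filter-⊎ (contains? T 𝟐) (mixed? T) (pure? T 𝟐) (All.universal split (columns S))
      where
      split : ∀ j → _
      split j = classify , proj₂ , pure⇒contains , λ ((∋𝟏 , _) , pure) → pure𝟐⇒∌𝟏 pure ∋𝟏
        where
        classify : Contains T 𝟐 j → Mixed T j ⊎ Pure T 𝟐 j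
        classify ∋𝟐 with contains? T 𝟏 j
        ... | yes ∋𝟏 = inj₁ (∋𝟏 , ∋𝟐)
        ... | no ∌𝟏  = inj₂ (pure-unless ≢𝟏⇒≡𝟐 (contains⇒nonempty ∋𝟐) ∌𝟏)

    -- No column being empty, each contains a 1 or is 2-pure.
    ircont𝟏+#pure𝟐 : ircont T 𝟏 + #columns T (pure? T 𝟐) ≡ n
    ircont𝟏+#pure𝟐 = begin
      ircont T 𝟏 + #columns T (pure? T 𝟐)
        ≡⟨ length-filter-⊎ (nonemptyColumn? S) (contains? T 𝟏) (pure? T 𝟐) (All.universal split (columns S)) ⟨
      length (filter (nonemptyColumn? S) (columns S))
        ≡⟨ cong length (filter-all (nonemptyColumn? S)
             (All.map (λ (1≤j , j≤n) → full _ 1≤j j≤n) columns-bounds)) ⟩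
      length (columns S)
        ≡⟨ trans (length-map suc (upTo n)) (length-applyUpTo id n) ⟩
      n ∎
      where
      open ≡-Reasoning
      split : ∀ j → _
      split j = classify , contains⇒nonempty , proj₁ , λ (∋𝟏 , pure) → pure𝟐⇒∌𝟏 pure ∋𝟏
        where
        classify : NonemptyColumn S j → Contains T 𝟏 j ⊎ Pure T 𝟐 j
        classify nonempty with contains? T 𝟏 j
        ... | yes ∋𝟏 = inj₁ ∋𝟏
        ... | no ∌𝟏  = inj₂ (pure-unless ≢𝟏⇒≡𝟐 nonempty ∌𝟏)

    #mixed+#𝟏+#𝟐 : length (seplist T) + (#columns T (pure? T 𝟏) + #columns T (pure? T 𝟐)) ≡ n
    #mixed+#𝟏+#𝟐 = begin
      length (seplist T) + (ones + twos)       ≡⟨ cong (_+ (ones + twos)) (#mixed≡length-seplist T) ⟨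
      #columns T (mixed? T) + (ones + twos)    ≡⟨ +-assoc (#columns T (mixed? T)) ones twos ⟨
      #columns T (mixed? T) + ones + twos      ≡⟨ cong (_+ twos) ircont𝟏 ⟨
      ircont T 𝟏 + twos                        ≡⟨ ircont𝟏+#pure𝟐 ⟩
      n                                        ∎
      where
      open ≡-Reasoning
      ones = #columns T (pure? T 𝟏)
      twos = #columns T (pure? T 𝟐)

  -- A support cell `(i , j)` gives `c < j`, and the cell below it gives `i < B j`, whence `j < b`.
  -- So all of `τ` is counted by `#within` on the interval from `c + 1` to `b`.
  irreducible⇒sparse : ∀ {ν} → Irreducible S ν → Sparse (parts ν)
  irreducible⇒sparse {ν} (_ , irreducible) c b {τ} c<b τ⊆ν ends =
    ≤-<-trans (+-monoʳ-≤ (suc c) τ≤within)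
      (subst (_< b) (+-comm (#within S ν a (ℤ.+ b)) (suc c)) (ℤ.drop‿+<+ bound))
    where
    a : ℤ
    a = ℤ.+ suc c

    within : All (SuppWithin S a (ℤ.+ b)) τ
    within = All.map (λ (starts , B≤i) {_} (c∈ , d∈) →
        ℤ.+≤+ (starts (∈⇒1≤col c∈) (∈⇒A< c∈)) ,
        ℤ.+<+ (≰⇒> λ b≤j → <⇒≱ (∈⇒≤B d∈) (≤-trans (B-antitone b≤j) B≤i)))
      ends

    τ≤within : length τ ≤ #within S ν a (ℤ.+ b)
    τ≤within = subst (λ τ′ → length τ′ ≤ #within S ν a (ℤ.+ b))
      (filter-all (suppWithin? S a (ℤ.+ b)) within)
      (length-mono-≤ (filter⁺ (suppWithin? S a (ℤ.+ b)) (suppWithin? S a (ℤ.+ b)) (λ { refl p → p }) τ⊆ν))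

    bound : ℤ.+ (#within S ν a (ℤ.+ b) + suc c) ℤ.< ℤ.+ b
    bound = subst (ℤ.+ (#within S ν a (ℤ.+ b) + suc c) ℤ.<_) cancel
      (ℤ.+-monoˡ-< a (irreducible a (ℤ.+ b) (ℤ.+<+ c<b)))
      where
      open ≡-Reasoning
      cancel : (ℤ.+ b ℤ.- a) ℤ.+ a ≡ ℤ.+ b
      cancel = begin
        (ℤ.+ b ℤ.- a) ℤ.+ a        ≡⟨ ℤ.+-assoc (ℤ.+ b) (ℤ.- a) a ⟩
        ℤ.+ b ℤ.+ (ℤ.- a ℤ.+ a)    ≡⟨ cong (λ z → ℤ.+ b ℤ.+ z) (ℤ.+-inverseˡ a) ⟩
        ℤ.+ b ℤ.+ ℤ.0ℤ             ≡⟨ ℤ.+-identityʳ (ℤ.+ b) ⟩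
        ℤ.+ b                      ∎

#pure-cong : ∀ {S} {T U : 12-RPP S} e → T ≈ᵀ U → #columns T (pure? T e) ≡ #columns U (pure? U e)
#pure-cong {S} {T} {U} e T≈U = cong length (filter-≐ (pure? T e) (pure? U e)
  ( (λ (nonempty , pure) → nonempty , λ i p → trans (sym (T≈U _)) (pure i p))
  , (λ (nonempty , pure) → nonempty , λ i p → trans (T≈U _) (pure i p)))
  (columns S))

-- Classification of the fillings for irreducible `ν`.

module Classification
  (S : SkewPartition) (ν : Partition)
  (connected : Connected S) (full : NoEmptyColumns S) (irreducible : Irreducible S ν)
  where

  open Columns S using (B; B-antitone)
  open Fillings S connected full
  open Setoid (RPP¹² S ν) using () renaming (Carrier to Filling; _≈_ to _≈ᶠ_)

  N : ℕ
  N = λ₁ S ∸ # ν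

  ones twos : Filling → ℕ
  ones (T , _) = #columns T (pure? T 𝟏)
  twos (T , _) = #columns T (pure? T 𝟐)

  sorted : Sorted (parts ν)
  sorted = parts-sorted ν

  sparse : Sparse (parts ν)
  sparse = irreducible⇒sparse {ν} irreducible

  -- Supports start at column 1 or later, hence `c = 0`; deadlines from column 2 on imply those from
  -- column 1 on.
  onTime : OnTime 1 (parts ν)
  onTime = onTime-pred (parts ν)
    (sparse⇒onTime {c = 0} sorted sparse (All.universal (λ _ {_} 1≤j _ → 1≤j) (parts ν)))

  #ν≤λ₁ : # ν ≤ λ₁ S
  #ν≤λ₁ = ≤-pred (onTime-length (parts ν) (s≤s z≤n) onTime)

  ones+twos≡N : ∀ T → ones T + twos T ≡ N
  ones+twos≡N TT@(T , sep≡) = sym (trans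
    (cong (_∸ # ν) (sym (trans (cong (λ xs → length xs + (ones TT + twos TT)) (sym sep≡)) (#mixed+#𝟏+#𝟐 T))))
    (m+n∸m≡n (# ν) (ones TT + twos TT)))

  ones≤N : ∀ T → ones T ≤ N
  ones≤N T = subst (ones T ≤_) (ones+twos≡N T) (m≤m+n (ones T) (twos T))

  twos≤N : ∀ T → twos T ≤ N
  twos≤N T = subst (twos T ≤_) (ones+twos≡N T) (m≤n+m (twos T) (ones T))

  twos≡N∸ones : ∀ T → twos T ≡ N ∸ ones T
  twos≡N∸ones T = trans (sym (m+n∸m≡n (ones T) (twos T))) (cong (_∸ ones T) (ones+twos≡N T))

  ones≡N∸twos : ∀ T → ones T ≡ N ∸ twos T
  ones≡N∸twos T = trans (sym (m+n∸n≡m (ones T) (twos T))) (cong (_∸ twos T) (ones+twos≡N T))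

  #mixed≡#ν : ∀ (T : Filling) → #columns (proj₁ T) (mixed? (proj₁ T)) ≡ # ν
  #mixed≡#ν (T , sep≡) = trans (#mixed≡length-seplist T) (cong length sep≡)

  columnCounts : ∀ T → ColumnCounts (proj₁ T) (# ν) (ones T) (N ∸ ones T)
  columnCounts T = #mixed≡#ν T , refl , twos≡N∸ones T

  ones-injective : ∀ T U → ones T ≡ ones U → T ≈ᶠ U
  ones-injective (T , refl) (U , sep≡) = seplist-unique sorted sparse (sym sep≡)

  filling : ∀ m → m ≤ N → Σ[ T ∈ Filling ] ones T ≡ m
  filling m m≤N =
    let hs , w = word-exists (λ₁ S) {0} {B 0} refl (parts ν) m sorted sparse onTime
          (subst (m + # ν ≤_) (m∸n+n≡m #ν≤λ₁) (+-monoˡ-≤ (# ν) m≤N))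
          -- The virtual column 0 has height `B 0`, which bounds every `B j`, so the premises on the
          -- preceding column hold at the start.
          (All.map (λ i<B _ → ≤-trans (<⇒≤ i<B) (B-antitone z≤n)) (onTime⇒< (parts ν) onTime))
          (λ _ _ → B-antitone z≤n)
        sep≡ , ones≡ = fromWord-statistics w
    in (fromWord w , sep≡) , ones≡

  -- The index is the number of 2-columns because term `k` of `P` contains `x₂ ^ k`.
  fillings-by-twos : Inverse (setoid (Fin (suc N))) (RPP¹² S ν)
  fillings-by-twos = record
    { to        = to
    ; from      = from
    ; to-cong   = λ { refl _ → refl }
    ; from-cong = λ {T} {U} T≈U → from-unique T (from U)
                    (trans (#pure-cong 𝟐 T≈U) (sym (toℕ-from U)))
    ; inverse   =
        (λ { {T} refl → ones-injective (to (from T)) T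
               (trans (ones-to (from T)) (trans (cong (N ∸_) (toℕ-from T)) (sym (ones≡N∸twos T)))) })
      , (λ {k} {T} T≈to → from-unique T k (trans (#pure-cong 𝟐 T≈to) (twos-to k)))
    }
    where
    to : Fin (suc N) → Filling
    to k = proj₁ (filling (N ∸ toℕ k) (m∸n≤m N (toℕ k)))

    from : Filling → Fin (suc N)
    from T = fromℕ< (s≤s (twos≤N T))

    toℕ-from : ∀ T → toℕ (from T) ≡ twos T
    toℕ-from T = toℕ-fromℕ< (s≤s (twos≤N T))

    from-unique : ∀ T k → twos T ≡ toℕ k → from T ≡ k
    from-unique T k twos≡k = toℕ-injective (trans (toℕ-from T) twos≡k)

    ones-to : ∀ k → ones (to k) ≡ N ∸ toℕ k
    ones-to k = proj₂ (filling (N ∸ toℕ k) (m∸n≤m N (toℕ k)))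

    twos-to : ∀ k → twos (to k) ≡ toℕ k
    twos-to k = trans (twos≡N∸ones (to k))
      (trans (cong (N ∸_) (ones-to k)) (m∸[m∸n]≡n (toℕ≤pred[n] k)))

  toℕ-from≡twos : ∀ T → toℕ (Inverse.from fillings-by-twos T) ≡ twos T
  toℕ-from≡twos T = toℕ-fromℕ< (s≤s (twos≤N T))

  -- The generating function.

  module _ {c ℓ} (R : CommutativeRing c ℓ) (x₁ x₂ : CommutativeRing.Carrier R) where

    open CommutativeRing R
      using (_*_; commutativeSemiring; semiring)
      renaming (Carrier to Value; _≈_ to _≈ᴿ_; setoid to valueSetoid; sym to symᴿ)
    open Polynomials R
    open SemiringExp semiring using (^-homo-*)
    open CommutativeExp commutativeSemiring using (^-distrib-*)
    open SemiringSum semiring using (sum; sum-cong-≋; sum-permute; *-distribˡ-sum)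
    open CommutativeSemigroup (CommutativeRing.*-commutativeSemigroup R) using (interchange)
    open import Relation.Binary.Reasoning.Setoid valueSetoid

    monomial : Fin (suc N) → Value
    monomial k = x₁ ^ (N ∸ toℕ k) * x₂ ^ toℕ k

    -- A mixed column contributes `x₁ * x₂`, a pure one a single variable.
    x^ircont≈ : ∀ T → x^ircont x₁ x₂ (proj₁ T) ≈ᴿ
      (x₁ * x₂) ^ # ν * monomial (Inverse.from fillings-by-twos T)
    x^ircont≈ T = begin
      x₁ ^ ircont (proj₁ T) 𝟏 * x₂ ^ ircont (proj₁ T) 𝟐
        ≡⟨ cong₂ (λ a b → x₁ ^ a * x₂ ^ b)
             (trans (ircont𝟏 (proj₁ T)) (cong₂ _+_ (#mixed≡#ν T) (ones≡N∸twos T)))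
             (trans (ircont𝟐 (proj₁ T)) (cong (_+ twos T) (#mixed≡#ν T))) ⟩
      x₁ ^ (# ν + (N ∸ twos T)) * x₂ ^ (# ν + twos T)
        ≈⟨ CommutativeRing.*-cong R (^-homo-* x₁ (# ν) (N ∸ twos T)) (^-homo-* x₂ (# ν) (twos T)) ⟩
      (x₁ ^ # ν * x₁ ^ (N ∸ twos T)) * (x₂ ^ # ν * x₂ ^ twos T)
        ≈⟨ interchange _ _ _ _ ⟩
      (x₁ ^ # ν * x₂ ^ # ν) * (x₁ ^ (N ∸ twos T) * x₂ ^ twos T)
        ≈⟨ CommutativeRing.*-congʳ R (^-distrib-* x₁ x₂ (# ν)) ⟨
      (x₁ * x₂) ^ # ν * (x₁ ^ (N ∸ twos T) * x₂ ^ twos T)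
        ≡⟨ cong (λ k → (x₁ * x₂) ^ # ν * (x₁ ^ (N ∸ k) * x₂ ^ k)) (toℕ-from≡twos T) ⟨
      (x₁ * x₂) ^ # ν * monomial (Inverse.from fillings-by-twos T) ∎

    generating-function :
      IsSumOver (RPP¹² S ν) (x^ircont x₁ x₂ ∘ proj₁) ((x₁ * x₂) ^ # ν * P N x₁ x₂)
    generating-function = (suc N , fillings-by-twos) , λ n e → begin
      sum (x^ircont x₁ x₂ ∘ proj₁ ∘ Inverse.to e)
        ≈⟨ sum-cong-≋ (λ i → x^ircont≈ (Inverse.to e i)) ⟩
      sum (λ i → (x₁ * x₂) ^ # ν * monomial (Inverse.from fillings-by-twos (Inverse.to e i)))
        -- The enumeration `e` is arbitrary; followed by the inverse of `fillings-by-twos` it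
        -- becomes a bijection from `Fin n` to `Fin (suc N)` that reorders the terms.
        ≈⟨ sum-permute (λ k → (x₁ * x₂) ^ # ν * monomial k)
             (Composition.inverse e (Symmetry.inverse fillings-by-twos)) ⟨
      sum (λ k → (x₁ * x₂) ^ # ν * monomial k)
        ≈⟨ *-distribˡ-sum ((x₁ * x₂) ^ # ν) monomial ⟨
      (x₁ * x₂) ^ # ν * P N x₁ x₂ ∎

theorem7p5 : ∀ {c ℓ} (R : CommutativeRing c ℓ) (S : SkewPartition) (ν : Partition) →
  Connected S → NoEmptyColumns S → Irreducible S ν →
  let open CommutativeRing R using (_*_)
      open Polynomials R
  in (∀ m → m ≤ λ₁ S ∸ # ν →
        ∃! (Setoid._≈_ (RPP¹² S ν)) (λ T → ColumnCounts (proj₁ T) (# ν) m (λ₁ S ∸ # ν ∸ m)))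
   × (∀ (T : Setoid.Carrier (RPP¹² S ν)) →
        ∃[ m ] (m ≤ λ₁ S ∸ # ν × ColumnCounts (proj₁ T) (# ν) m (λ₁ S ∸ # ν ∸ m)))
   × (∀ (x₁ x₂ : CommutativeRing.Carrier R) →
        IsSumOver (RPP¹² S ν) (x^ircont x₁ x₂ ∘ proj₁)
          ((x₁ * x₂) ^ # ν * P (λ₁ S ∸ # ν) x₁ x₂))
theorem7p5 R S ν connected full irreducible =
    (λ m m≤N → let T , ones≡m = filling m m≤N in
       T
     , subst (λ m′ → ColumnCounts (proj₁ T) (# ν) m′ (N ∸ m′)) ones≡m (columnCounts T)
     , λ {U} (_ , onesU≡m , _) → ones-injective T U (trans ones≡m (sym onesU≡m)))
  , (λ T → ones T , ones≤N T , columnCounts T)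
  , generating-function R
  where open Classification S ν connected full irreducible
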